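{- Let $\alpha=(\alpha_1,\dots,\alpha_t)$ be palindromic (i.e. $\alpha_i=\alpha_{t+1-i}$ for all $i$) with $t$ odd, let $F=\breve F(\alpha)$ with elements $x_1,\dots,x_n$ and shared elements $s_1,\dots,s_{t-1}$. Assume that $\hat\chi_{s_i}+\hat\chi_{s_{t-i}}$ is $1$-mesic under rowmotion for all $i\in[t-1]$. Then (1) $\hat\chi_{x_k}+\hat\chi_{x_{n-k+1}}$ is $1$-mesic for all $k\in[n]$, and (2) $\chi_{x_k}-\chi_{x_{n-k+1}}$ is $0$-mesic for all $k\in[n]$.
   Context: A fence $\breve F(\alpha_1,\dots,\alpha_t)$ ($t\ge2$, positive integers, $\alpha_1,\alpha_t\ge2$) is the poset on $\{x_1,\dots,x_n\}$, $n=\alpha_1+\dots+\alpha_t-1$, with $a_i=\alpha_1+\dots+\alpha_i$, $a_0=0$, whose cover relations are: for $1\le j\le n-1$ with $a_{i-1}\le j<a_i$, $x_j\lessdot x_{j+1}$ if $i$ odd and $x_j\gtrdot x_{j+1}$ if $i$ even. Shared elements: $s_i=x_{a_i}$. $\mathcal J(F)$ is the set of order ideals; rowmotion $\rho$ sends $I$ to the order ideal generated by $\min(F\setminus I)$. $\hat\chi_q(I)=1$ if $q\in I$, else 0; $\chi_q(I)=1$ if $q\in\max(I)$, else 0. A statistic $f:\mathcal J(F)\to\mathbb R$ is $c$-mesic under rowmotion if its average over every $\rho$-orbit equals $c$. -}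

module Defs where

open import Data.Fin.Base using (Fin; zero; suc; toℕ; fromℕ<; opposite)
open import Data.Fin.Properties using (any?; all?; _≟_; toℕ<n)
open import Data.Fin.Subset using (Subset; _∈_; ∁)
open import Data.Fin.Subset.Properties using (_∈?_)
import Data.Integer.Base as ℤ
open import Data.List.Base as List using (List; []; _∷_; applyUpTo; allFin)
open import Data.List.Membership.Propositional using () renaming (_∈_ to _∈ˡ_)
open import Data.List.Membership.Propositional.Properties using (∈-allFin)
open import Data.List.Relation.Unary.Any using (here; there)
open import Data.Nat.Base as ℕ using (ℕ; zero; suc; _+_; _∸_; pred; parity; NonZero; _≤_; _<_; s≤s)
open import Data.Nat.GeneralisedArithmetic using (fold)
open import Data.Nat.ListAction using (sum)
open import Data.Nat.Properties as ℕₚ using (≤-trans; m≤m+n; +-monoʳ-<; pred-mono-<)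
open import Data.Parity.Base using (0ℙ; 1ℙ)
import Data.Parity.Properties as ℙ
open import Data.Product.Base using (∃; _×_; _,_)
open import Data.Rational.Base as ℚ using (ℚ; 0ℚ; 1ℚ)
open import Data.Sum.Base using (_⊎_; inj₁; inj₂)
open import Data.Vec.Base as Vec using (Vec; []; _∷_; lookup; tabulate; toList)
open import Data.Vec.Properties using ([]=⇒lookup; lookup⇒[]=; lookup∘tabulate)
open import Data.Bool.Base using (if_then_else_)
open import Level using (0ℓ)
open import Relation.Binary.Core using (Rel)
open import Relation.Binary.Definitions using (Decidable; Transitive)
open import Relation.Binary.Construct.Closure.ReflexiveTransitive using (Star; ε; _◅_; _◅◅_)
open import Relation.Binary.PropositionalEquality using (_≡_; _≢_; refl; sym; trans)
open import Relation.Nullary.Decidable using (Dec; yes; no; does; map′; _×-dec_; _⊎-dec_; _→-dec_; dec-true)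
import Relation.Unary as U

comprehension : ∀ {n} {P : Fin n → Set} → U.Decidable P → Subset n
comprehension P? = tabulate λ x → does (P? x)

module _ {n} {P : Fin n → Set} (P? : U.Decidable P) where

  ∈-comprehension⁺ : ∀ {x} → P x → x ∈ comprehension P?
  ∈-comprehension⁺ {x} px =
    lookup⇒[]= x _ (trans (lookup∘tabulate _ x) (dec-true (P? x) px))

  ∈-comprehension⁻ : ∀ {x} → x ∈ comprehension P? → P x
  ∈-comprehension⁻ {x} x∈ with P? x | trans (sym (lookup∘tabulate _ x)) ([]=⇒lookup x∈)
  ... | yes px | _ = px
  ... | no _   | ()

-- Decidability of the reflexive transitive closure of a decidable relation on
-- Fin n, by the Floyd–Warshall recursion: Via vs x y asserts a path from x to
-- y all of whose intermediate vertices lie in vs.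
module _ {n} {R : Rel (Fin n) 0ℓ} (R? : Decidable R) where

  private
    Via : List (Fin n) → Rel (Fin n) 0ℓ
    Via []       x y = x ≡ y ⊎ R x y
    Via (v ∷ vs) x y = Via vs x y ⊎ (Via vs x v × Via vs v y)

    via? : ∀ vs → Decidable (Via vs)
    via? []       x y = (x ≟ y) ⊎-dec R? x y
    via? (v ∷ vs) x y = via? vs x y ⊎-dec (via? vs x v ×-dec via? vs v y)

    step : ∀ vs {x y} → x ≡ y ⊎ R x y → Via vs x y
    step []       e = e
    step (v ∷ vs) e = inj₁ (step vs e)

    toStar : ∀ vs {x y} → Via vs x y → Star R x y
    toStar []       (inj₁ refl)    = ε
    toStar []       (inj₂ r)       = r ◅ ε
    toStar (v ∷ vs) (inj₁ p)       = toStar vs p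
    toStar (v ∷ vs) (inj₂ (p , q)) = toStar vs p ◅◅ toStar vs q

    into : ∀ {u vs x} → Via (u ∷ vs) x u → Via vs x u
    into (inj₁ p)       = p
    into (inj₂ (p , _)) = p

    outOf : ∀ {u vs y} → Via (u ∷ vs) u y → Via vs u y
    outOf (inj₁ p)       = p
    outOf (inj₂ (_ , p)) = p

    join : ∀ {v} vs {x y} → v ∈ˡ vs → Via vs x v → Via vs v y → Via vs x y
    join (u ∷ vs) (here refl) p q = inj₂ (into {vs = vs} p , outOf {vs = vs} q)
    join (u ∷ vs) (there v∈) (inj₁ p)       (inj₁ q)       = inj₁ (join vs v∈ p q)
    join (u ∷ vs) (there v∈) (inj₁ p)       (inj₂ (q , r)) = inj₂ (join vs v∈ p q , r)
    join (u ∷ vs) (there v∈) (inj₂ (p , q)) (inj₁ r)       = inj₂ (p , join vs v∈ q r)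
    join (u ∷ vs) (there v∈) (inj₂ (p , _)) (inj₂ (_ , r)) = inj₂ (p , r)

    fromStar : ∀ {x y} → Star R x y → Via (allFin n) x y
    fromStar ε       = step (allFin n) (inj₁ refl)
    fromStar (r ◅ p) =
      join (allFin n) (∈-allFin _) (step (allFin n) (inj₂ r)) (fromStar p)

  star? : Decidable (Star R)
  star? x y = map′ (toStar (allFin n)) fromStar (via? (allFin n) x y)

module Rowmotion {n : ℕ} {_≼_ : Rel (Fin n) 0ℓ}
                 (_≼?_ : Decidable _≼_) (≼-trans : Transitive _≼_) where

  IsMinimalIn IsMaximalIn : Subset n → Fin n → Set
  IsMinimalIn S x = x ∈ S × (∀ y → y ∈ S → y ≼ x → y ≡ x)
  IsMaximalIn S x = x ∈ S × (∀ y → y ∈ S → x ≼ y → y ≡ x)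

  isMinimalIn? : ∀ S → U.Decidable (IsMinimalIn S)
  isMinimalIn? S x = (x ∈? S) ×-dec
    all? λ y → (y ∈? S) →-dec ((y ≼? x) →-dec (y ≟ x))

  isMaximalIn? : ∀ S → U.Decidable (IsMaximalIn S)
  isMaximalIn? S x = (x ∈? S) ×-dec
    all? λ y → (y ∈? S) →-dec ((x ≼? y) →-dec (y ≟ x))

  min max : Subset n → Subset n
  min S = comprehension (isMinimalIn? S)
  max S = comprehension (isMaximalIn? S)

  record OrderIdeal : Set where
    constructor orderIdeal
    field
      set        : Subset n
      downClosed : ∀ {x y} → x ≼ y → y ∈ set → x ∈ set

  open OrderIdeal public

  BelowSome : Subset n → Fin n → Set
  BelowSome S x = ∃ λ y → y ∈ S × x ≼ y

  belowSome? : ∀ S → U.Decidable (BelowSome S)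
  belowSome? S x = any? λ y → (y ∈? S) ×-dec (x ≼? y)

  generatedBy : Subset n → OrderIdeal
  generatedBy S = orderIdeal (comprehension (belowSome? S)) λ x≼y y∈ →
    let (z , z∈S , y≼z) = ∈-comprehension⁻ (belowSome? S) y∈
    in ∈-comprehension⁺ (belowSome? S) (z , z∈S , ≼-trans x≼y y≼z)

  ρ : OrderIdeal → OrderIdeal
  ρ I = generatedBy (min (∁ (set I)))

  ρ^_ : ℕ → OrderIdeal → OrderIdeal
  (ρ^ k) I = fold I ρ k

  -- A ρ-orbit, presented as the cycle start, ρ start, …, ρ^(size-1) start, where
  -- size is the least positive period of start; by minimality the listed ideals
  -- are distinct.  Ideals are compared through their underlying subsets, since
  -- downClosed is proof-relevant.
  record Orbit : Set where
    field
      start       : OrderIdeal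
      size        : ℕ
      {{nonZero}} : NonZero size
      returns     : set ((ρ^ size) start) ≡ set start
      minimal     : ∀ k → 0 < k → k < size → set ((ρ^ k) start) ≢ set start

    elements : List OrderIdeal
    elements = applyUpTo (λ k → (ρ^ k) start) size

  -- ℚ replaces ℝ as codomain.
  Statistic : Set
  Statistic = OrderIdeal → ℚ

  infixl 6 _⊕_ _⊖_

  _⊕_ _⊖_ : Statistic → Statistic → Statistic
  (f ⊕ g) I = f I ℚ.+ g I
  (f ⊖ g) I = f I ℚ.- g I

  average : Statistic → Orbit → ℚ
  average f O = (ℤ.+ 1 ℚ./ size) ℚ.* List.foldr ℚ._+_ 0ℚ (List.map f elements)
    where open Orbit O

  _IsMesic_ : Statistic → ℚ → Set
  f IsMesic c = ∀ O → average f O ≡ c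

  indicator : Subset n → Fin n → ℚ
  indicator S q = if does (q ∈? S) then 1ℚ else 0ℚ

  χ̂ χ : Fin n → Statistic
  χ̂ q I = indicator (set I) q
  χ  q I = indicator (max (set I)) q

partialSum : ∀ {t} → Vec ℕ t → ℕ → ℕ
partialSum α i = sum (List.take i (toList α))

partialSum<sum : ∀ {t} (α : Vec ℕ t) → (∀ i → 1 ≤ lookup α i) →
                 ∀ {i} → i < t → partialSum α i < Vec.sum α
partialSum<sum (x ∷ α) pos {zero}  _         = ≤-trans (pos zero) (m≤m+n x _)
partialSum<sum (x ∷ α) pos {suc i} (s≤s i<t) =
  +-monoʳ-< x (partialSum<sum α (λ j → pos (suc j)) i<t)

-- The parameters of a fence with t = 2 + m segments; lookup α i is the part
-- with 1-based index toℕ i + 1.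
record FenceParameters (m : ℕ) : Set where
  field
    α       : Vec ℕ (2 + m)
    α≥1     : ∀ i → 1 ≤ lookup α i
    2≤first : 2 ≤ Vec.head α
    2≤last  : 2 ≤ Vec.last α

  IsPalindromic : Set
  IsPalindromic = ∀ i → lookup α i ≡ lookup α (opposite i)

module Fence {m : ℕ} (P : FenceParameters m) where
  open FenceParameters P

  a : ℕ → ℕ
  a = partialSum α

  n : ℕ
  n = Vec.sum α ∸ 1

  -- The element x_k is the p : Fin n with index p ≡ k.
  index : Fin n → ℕ
  index p = suc (toℕ p)

  InSegment : ℕ → Fin (2 + m) → Set
  InSegment j i = a (toℕ i) ≤ j × j < a (suc (toℕ i))

  inSegment? : ∀ j i → Dec (InSegment j i)
  inSegment? j i = (a (toℕ i) ℕₚ.≤? j) ×-dec (j ℕₚ.<? a (suc (toℕ i)))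

  -- In the second alternative the lower-indexed element x_j is q, and p = x_{j+1}.
  _⋖_ : Rel (Fin n) 0ℓ
  p ⋖ q = ∃ λ i →
      (index q ≡ suc (index p) × InSegment (index p) i × parity (suc (toℕ i)) ≡ 1ℙ)
    ⊎ (index p ≡ suc (index q) × InSegment (index q) i × parity (suc (toℕ i)) ≡ 0ℙ)

  _⋖?_ : Decidable _⋖_
  p ⋖? q = any? λ i →
      ((index q ℕₚ.≟ suc (index p)) ×-dec (inSegment? (index p) i ×-dec (parity (suc (toℕ i)) ℙ.≟ 1ℙ)))
    ⊎-dec
      ((index p ℕₚ.≟ suc (index q)) ×-dec (inSegment? (index q) i ×-dec (parity (suc (toℕ i)) ℙ.≟ 0ℙ)))

  _≼_ : Rel (Fin n) 0ℓ
  _≼_ = Star _⋖_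

  _≼?_ : Decidable _≼_
  _≼?_ = star? _⋖?_

  open Rowmotion _≼?_ _◅◅_ public

  -- s i is the shared element x_{a_j} with j = toℕ i + 1 ranging over [t - 1],
  -- so s (opposite i) is the one with index t - j.
  s : Fin (suc m) → Fin n
  s i = fromℕ< {pred (a (suc (toℕ i)))} (bound i)
    where
    a-positive : ∀ k {t} (β : Vec ℕ (suc t)) → (∀ i → 1 ≤ lookup β i) →
                 1 ≤ partialSum β (suc k)
    a-positive k (x ∷ β) pos = ≤-trans (pos zero) (m≤m+n x _)

    bound : ∀ i → pred (a (suc (toℕ i))) < n
    bound i = pred-mono-<
      {{ℕ.>-nonZero (a-positive (toℕ i) α α≥1)}}
      (partialSum<sum α α≥1 (s≤s (toℕ<n i)))

{-# OPTIONS --safe #-}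
-- Give every element x_j its order-ideal indicator, and add a virtual x_0 lying
-- in every ideal and a virtual x_{n+1} lying in none.  Inside a segment, x_k is
-- maximal in I, respectively in ρ I, exactly when I separates x_k from its upper,
-- respectively lower, neighbour.  Rowmotion preserves orbit averages, so the
-- average of χ_{x_k} is a difference of averages of consecutive indicators in two
-- ways; hence the indicator averages are affine in k along each segment.  So is
-- their sum with the mirror image, which is 1 at all ends of segments and hence
-- everywhere.  Comparing the two descriptions of χ at x_k and at its mirror image
-- gives the second claim.
module Submission where

open import Defs
open import Data.Bool.Base using (if_then_else_)
open import Data.Fin.Base using (Fin; zero; suc; toℕ; fromℕ<; opposite)
open import Data.Fin.Properties
  using (any?; toℕ<n; toℕ-fromℕ<; toℕ-injective; opposite-prop; opposite-involutive)
open import Data.Fin.Subset using (_∈_; _∉_; ∁)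
open import Data.Fin.Subset.Properties using (_∈?_; x∈∁p⇒x∉p; x∉p⇒x∈∁p; x∉∁p⇒x∈p)
import Data.Integer.Base as ℤ
import Data.Integer.Properties as ℤₚ
open import Data.List.Base as List using (applyUpTo)
open import Data.List.Properties using (map-applyUpTo)
open import Data.Nat.Base as ℕ using (ℕ; zero; suc; _+_; _∸_; parity; z≤n; s≤s; _≤_; _<_)
open import Data.Nat.Properties as ℕₚ
  using (+-suc; +-comm; +-assoc; +-identityʳ; ≤-trans; ≤-reflexive; m∸n+n≡m)
open import Data.Parity.Base as ℙ using (Parity; 0ℙ; 1ℙ)
import Data.Parity.Properties as ℙₚ
open import Data.Product.Base using (∃; _×_; _,_; proj₁; proj₂)
open import Data.Rational.Base as ℚ using (ℚ; 0ℚ; 1ℚ; Positive)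
import Data.Rational.Properties as ℚₚ
import Data.Rational.Unnormalised.Base as ℚᵘ
import Data.Rational.Unnormalised.Properties as ℚᵘₚ
open import Data.Rational.Solver using (module +-*-Solver)
open import Data.Sum.Base using (_⊎_; inj₁; inj₂)
open import Data.Unit.Base using (⊤)
open import Data.Vec.Base as Vec using (Vec; _∷_; []; lookup)
open import Function.Base using (_∘_)
open import Function.Bundles using (_⇔_; mk⇔; module Equivalence)
open import Function.Construct.Composition using (_⇔-∘_)
open import Relation.Binary.Construct.Closure.ReflexiveTransitive using (Star; ε; _◅_; _◅◅_)
open import Relation.Binary.Core using (Rel)
open import Relation.Binary.Definitions using (Decidable; Transitive; tri<; tri≈; tri>)
open import Relation.Binary.PropositionalEquality
open import Relation.Nullary.Decidable
  using (Dec; yes; no; does; dec-true; dec-false; does-⇔; _×-dec_; _⊎-dec_)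
open import Relation.Nullary.Negation using (¬_; contradiction)
open import Level using (0ℓ)
open import Algebra.Properties.Group ℚₚ.+-0-group using () renaming (∙-cancelʳ to +-cancelʳ)
open +-*-Solver using (solve; _:=_; _:+_; _:-_; _:*_; :-_; con)

-- Rational-valued indicators of decidable propositions.

private variable
  P Q R : Set

⟦_⟧ : Dec P → ℚ
⟦ p? ⟧ = if does p? then 1ℚ else 0ℚ

⟦⟧-cong : P ⇔ Q → (p? : Dec P) (q? : Dec Q) → ⟦ p? ⟧ ≡ ⟦ q? ⟧
⟦⟧-cong P⇔Q p? q? = cong (if_then 1ℚ else 0ℚ) (does-⇔ P⇔Q p? q?)

⟦⟧-true : (p? : Dec P) → P → ⟦ p? ⟧ ≡ 1ℚ
⟦⟧-true p? p = cong (if_then 1ℚ else 0ℚ) (dec-true p? p)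

⟦⟧-false : (p? : Dec P) → ¬ P → ⟦ p? ⟧ ≡ 0ℚ
⟦⟧-false p? ¬p = cong (if_then 1ℚ else 0ℚ) (dec-false p? ¬p)

-- Indicators subtract because the propositions are nested. Typically `P` and `Q` are membership of
-- the two ends of an edge, and `R` says that the ideal cuts this edge.
⟦⟧-difference : (Q → P) → R ⇔ (P × ¬ Q) → (r? : Dec R) (p? : Dec P) (q? : Dec Q) →
                ⟦ r? ⟧ ≡ ⟦ p? ⟧ ℚ.- ⟦ q? ⟧
⟦⟧-difference Q⇒P R⇔ r? (yes p) (yes q) = ⟦⟧-false r? λ r → proj₂ (Equivalence.to R⇔ r) q
⟦⟧-difference Q⇒P R⇔ r? (yes p) (no ¬q) = ⟦⟧-true r? (Equivalence.from R⇔ (p , ¬q))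
⟦⟧-difference Q⇒P R⇔ r? (no ¬p) (yes q) = contradiction (Q⇒P q) ¬p
⟦⟧-difference Q⇒P R⇔ r? (no ¬p) (no _)  = ⟦⟧-false r? λ r → ¬p (proj₁ (Equivalence.to R⇔ r))

-- Sequences that are affine between their zeros.

r*d≡0⇒d≡0 : ∀ r d .{{_ : Positive r}} → r ℚ.* d ≡ 0ℚ → d ≡ 0ℚ
r*d≡0⇒d≡0 r d rd≡0 = ℚₚ.≤-antisym
  (ℚₚ.*-cancelˡ-≤-pos r (ℚₚ.≤-reflexive rd≡r0))
  (ℚₚ.*-cancelˡ-≤-pos r (ℚₚ.≤-reflexive (sym rd≡r0)))
  where
  rd≡r0 : r ℚ.* d ≡ r ℚ.* 0ℚ
  rd≡r0 = trans rd≡0 (sym (ℚₚ.*-zeroʳ r))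

module PiecewiseAffine
  (N : ℕ) (D : ℕ → ℚ) (D₀ : D 0 ≡ 0ℚ) (Dₙ : D N ≡ 0ℚ)
  (node : ∀ k → suc k < N →
          D (suc k) ≡ 0ℚ ⊎ D (2 + k) ℚ.- D (suc k) ≡ D (suc k) ℚ.- D k)
  where

  -- r counts the steps since the last zero of D, along which the slope is constant.
  slope≡0 : ∀ c k r .{{_ : Positive r}} → c + suc k ≡ N →
            D (suc k) ≡ r ℚ.* (D (suc k) ℚ.- D k) → D (suc k) ℚ.- D k ≡ 0ℚ
  slope≡0 zero    k r refl eq = r*d≡0⇒d≡0 r _ (trans (sym eq) Dₙ)
  slope≡0 (suc c) k r refl eq with node k (s≤s (ℕₚ.m≤n+m (suc k) c))
  ... | inj₁ z      = r*d≡0⇒d≡0 r _ (trans (sym eq) z)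
  ... | inj₂ affine = trans (sym affine)
    (slope≡0 c (suc k) (r ℚ.+ 1ℚ) {{ℚₚ.pos+pos⇒pos r 1ℚ}} (+-suc c (suc k)) (begin
      D (2 + k)
        ≡⟨ solve 2 (λ x y → x := y :+ (x :- y)) refl (D (2 + k)) (D (suc k)) ⟩
      D (suc k) ℚ.+ (D (2 + k) ℚ.- D (suc k))   ≡⟨ cong (ℚ._+ (D (2 + k) ℚ.- D (suc k))) eq ⟩
      r ℚ.* (D (suc k) ℚ.- D k) ℚ.+ d           ≡⟨ cong (λ e → r ℚ.* e ℚ.+ d) (sym affine) ⟩
      r ℚ.* d ℚ.+ d
        ≡⟨ solve 2 (λ r d → r :* d :+ d := (r :+ con 1ℚ) :* d) refl r d ⟩
      (r ℚ.+ 1ℚ) ℚ.* d                          ∎))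
    where
    open ≡-Reasoning
    d = D (2 + k) ℚ.- D (suc k)

  -- From left to right: once `D k` vanishes, `D (suc k)` equals the slope leading to it, so
  -- `slope≡0` starts with `r = 1` at distance `N ∸ suc k` from the right end. The next zero of `D`
  -- forces that slope to vanish.
  zero-everywhere : ∀ k → k ≤ N → D k ≡ 0ℚ
  zero-everywhere zero    _   = D₀
  zero-everywhere (suc k) k<N = begin
    D (suc k)                    ≡⟨ first-step ⟩
    1ℚ ℚ.* (D (suc k) ℚ.- D k)   ≡⟨ ℚₚ.*-identityˡ _ ⟩
    D (suc k) ℚ.- D k            ≡⟨ slope≡0 (N ∸ suc k) k 1ℚ (m∸n+n≡m k<N) first-step ⟩
    0ℚ                           ∎
    where
    open ≡-Reasoning
    first-step : D (suc k) ≡ 1ℚ ℚ.* (D (suc k) ℚ.- D k)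
    first-step = sym (trans (cong (λ z → 1ℚ ℚ.* (D (suc k) ℚ.- z)) (zero-everywhere k (ℕₚ.<⇒≤ k<N)))
      (solve 1 (λ x → con 1ℚ :* (x :- con 0ℚ) := x) refl (D (suc k))))

-- Finite sums of rationals.

∑< : ℕ → (ℕ → ℚ) → ℚ
∑< k g = List.foldr ℚ._+_ 0ℚ (applyUpTo g k)

∑<-cong : ∀ k {g h} → (∀ i → g i ≡ h i) → ∑< k g ≡ ∑< k h
∑<-cong zero    g≗h = refl
∑<-cong (suc k) g≗h = cong₂ ℚ._+_ (g≗h 0) (∑<-cong k (g≗h ∘ suc))

∑<-+ : ∀ k g h → ∑< k (λ i → g i ℚ.+ h i) ≡ ∑< k g ℚ.+ ∑< k h
∑<-+ zero    g h = refl
∑<-+ (suc k) g h = trans (cong ((g 0 ℚ.+ h 0) ℚ.+_) (∑<-+ k (g ∘ suc) (h ∘ suc)))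
  (solve 4 (λ a b c d → (a :+ b) :+ (c :+ d) := (a :+ c) :+ (b :+ d)) refl
    (g 0) (h 0) (∑< k (g ∘ suc)) (∑< k (h ∘ suc)))

∑<-neg : ∀ k g → ∑< k (λ i → ℚ.- g i) ≡ ℚ.- ∑< k g
∑<-neg zero    g = refl
∑<-neg (suc k) g = trans (cong (ℚ.- g 0 ℚ.+_) (∑<-neg k (g ∘ suc)))
  (sym (ℚₚ.neg-distrib-+ (g 0) (∑< k (g ∘ suc))))

-- Both sides add up `g 0` through `g k`; avoiding subtraction keeps the induction a plain
-- rearrangement.
∑<-shift : ∀ k (g : ℕ → ℚ) → ∑< k (λ i → g (suc i)) ℚ.+ g 0 ≡ ∑< k g ℚ.+ g k
∑<-shift zero    g = refl
∑<-shift (suc k) g = begin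
  (g 1 ℚ.+ s′) ℚ.+ g 0
    ≡⟨ solve 3 (λ a b c → (a :+ b) :+ c := c :+ (b :+ a)) refl (g 1) s′ (g 0) ⟩
  g 0 ℚ.+ (s′ ℚ.+ g 1)         ≡⟨ cong (g 0 ℚ.+_) (∑<-shift k (g ∘ suc)) ⟩
  g 0 ℚ.+ (∑< k (g ∘ suc) ℚ.+ g (suc k)) ≡⟨ ℚₚ.+-assoc (g 0) _ _ ⟨
  ∑< (suc k) g ℚ.+ g (suc k)   ∎
  where
  open ≡-Reasoning
  s′ = ∑< k (λ i → g (2 + i))

-- Division in `ℚ` hides numerator and denominator behind a reduction to lowest terms; the
-- unnormalised fraction keeps both in view.
toℚᵘ-/ : ∀ i d .{{_ : ℕ.NonZero d}} → ℚ.toℚᵘ (i ℚ./ d) ℚᵘ.≃ (i ℚᵘ./ d)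
toℚᵘ-/ i (suc d) = ℚₚ.toℚᵘ-fromℚᵘ (ℚᵘ.mkℚᵘ i d)

∑<-1 : ∀ k → ∑< k (λ _ → 1ℚ) ≡ (ℤ.+ k) ℚ./ 1
∑<-1 zero    = refl
∑<-1 (suc k) = trans (cong (1ℚ ℚ.+_) (∑<-1 k)) (ℚₚ.toℚᵘ-injective (begin
  ℚ.toℚᵘ (1ℚ ℚ.+ (ℤ.+ k) ℚ./ 1)            ≈⟨ ℚₚ.toℚᵘ-homo-+ 1ℚ ((ℤ.+ k) ℚ./ 1) ⟩
  ℚᵘ.1ℚᵘ ℚᵘ.+ ℚ.toℚᵘ ((ℤ.+ k) ℚ./ 1)       ≈⟨ ℚᵘₚ.+-congʳ ℚᵘ.1ℚᵘ (toℚᵘ-/ (ℤ.+ k) 1) ⟩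
  ℚᵘ.1ℚᵘ ℚᵘ.+ (ℤ.+ k) ℚᵘ./ 1
    ≈⟨ ℚᵘ.*≡* (cong (λ i → (ℤ.1ℤ ℤ.+ i) ℤ.* ℤ.1ℤ) (ℤₚ.*-identityʳ (ℤ.+ k))) ⟩
  (ℤ.+ suc k) ℚᵘ./ 1                       ≈⟨ toℚᵘ-/ (ℤ.+ suc k) 1 ⟨
  ℚ.toℚᵘ ((ℤ.+ suc k) ℚ./ 1)               ∎))
  where open ℚᵘₚ.≃-Reasoning

1/k*k≡1 : ∀ k .{{_ : ℕ.NonZero k}} → (ℤ.+ 1 ℚ./ k) ℚ.* ((ℤ.+ k) ℚ./ 1) ≡ 1ℚ
1/k*k≡1 k@(suc _) = ℚₚ.toℚᵘ-injective (begin
  ℚ.toℚᵘ ((ℤ.+ 1 ℚ./ k) ℚ.* ((ℤ.+ k) ℚ./ 1))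
    ≈⟨ ℚₚ.toℚᵘ-homo-* (ℤ.+ 1 ℚ./ k) ((ℤ.+ k) ℚ./ 1) ⟩
  ℚ.toℚᵘ (ℤ.+ 1 ℚ./ k) ℚᵘ.* ℚ.toℚᵘ ((ℤ.+ k) ℚ./ 1)
    ≈⟨ ℚᵘₚ.*-cong (toℚᵘ-/ (ℤ.+ 1) k) (toℚᵘ-/ (ℤ.+ k) 1) ⟩
  (ℤ.+ 1 ℚᵘ./ k) ℚᵘ.* ((ℤ.+ k) ℚᵘ./ 1)
    ≈⟨ ℚᵘ.*≡* (ℤₚ.*-assoc (ℤ.+ 1) (ℤ.+ k) (ℤ.+ 1)) ⟩
  ℚᵘ.1ℚᵘ                                                ∎)
  where open ℚᵘₚ.≃-Reasoning

-- Maximal elements of a rowmotion image, and averages over an orbit.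

module RowmotionProperties {n : ℕ} {_≼_ : Rel (Fin n) 0ℓ}
                           (_≼?_ : Decidable _≼_) (≼-trans : Transitive _≼_)
                           (≼-refl : ∀ {x} → x ≼ x) where
  open Rowmotion _≼?_ ≼-trans

  ∈max⇔ : ∀ S {x} → x ∈ max S ⇔ IsMaximalIn S x
  ∈max⇔ S = mk⇔ (∈-comprehension⁻ (isMaximalIn? S)) (∈-comprehension⁺ (isMaximalIn? S))

  -- The minimal elements of the complement form an antichain, and an ideal generated by an
  -- antichain has exactly that antichain as its maximal elements.
  max-ρ⇔min-∁ : ∀ I {x} → IsMaximalIn (set (ρ I)) x ⇔ IsMinimalIn (∁ (set I)) x
  max-ρ⇔min-∁ I {x} = mk⇔ to from
    where
    C = ∁ (set I)

    generated⁻ : ∀ {y} → y ∈ set (ρ I) → BelowSome (min C) y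
    generated⁻ = ∈-comprehension⁻ (belowSome? (min C))

    generated⁺ : ∀ {y z} → IsMinimalIn C z → y ≼ z → y ∈ set (ρ I)
    generated⁺ z-min y≼z = ∈-comprehension⁺ (belowSome? (min C))
      (_ , ∈-comprehension⁺ (isMinimalIn? C) z-min , y≼z)

    to : IsMaximalIn (set (ρ I)) x → IsMinimalIn C x
    to (x∈ , x-max) =
      let (z , z∈min , x≼z) = generated⁻ x∈
          z-min = ∈-comprehension⁻ (isMinimalIn? C) z∈min
      in subst (IsMinimalIn C) (x-max z (generated⁺ z-min ≼-refl) x≼z) z-min

    from : IsMinimalIn C x → IsMaximalIn (set (ρ I)) x
    from x-min@(x∈C , _) = generated⁺ x-min ≼-refl , λ y y∈ x≼y →
      let (z , z∈min , y≼z) = generated⁻ y∈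
          (_ , z-least) = ∈-comprehension⁻ (isMinimalIn? C) z∈min
          -- `x` lies in the complement below the minimal `z`, so they agree and `y` is below `x`
          -- too; minimality of `x` then gives `y ≡ x`.
          x≡z = z-least x x∈C (≼-trans x≼y y≼z)
          y∈C = x∉p⇒x∈∁p λ y∈I → x∈∁p⇒x∉p x∈C (downClosed I x≼y y∈I)
      in proj₂ x-min y y∈C (subst (y ≼_) (sym x≡z) y≼z)

  module _ (O : Orbit) where
    open Orbit O

    private
      value : Statistic → ℕ → ℚ
      value f k = f ((ρ^ k) start)

    -- Opaque, because unification would unfold averages down to ℚ arithmetic.
    opaque
      mean : Statistic → ℚ
      mean f = average f O

      mean≡average : ∀ f → mean f ≡ average f O
      mean≡average f = refl

    mean-∑ : ∀ f → mean f ≡ (ℤ.+ 1 ℚ./ size) ℚ.* ∑< size (value f)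
    mean-∑ f = trans (mean≡average f) (cong (λ l → (ℤ.+ 1 ℚ./ size) ℚ.* List.foldr ℚ._+_ 0ℚ l)
      (map-applyUpTo (λ k → (ρ^ k) start) f size))

    mean-cong : ∀ {f g : Statistic} → (∀ I → f I ≡ g I) → mean f ≡ mean g
    mean-cong {f} {g} f≗g = trans (mean-∑ f)
      (trans (cong ((ℤ.+ 1 ℚ./ size) ℚ.*_) (∑<-cong size (λ k → f≗g ((ρ^ k) start)))) (sym (mean-∑ g)))

    mean-⊕ : ∀ f g → mean (f ⊕ g) ≡ mean f ℚ.+ mean g
    mean-⊕ f g = begin
      mean (f ⊕ g)  ≡⟨ mean-∑ (f ⊕ g) ⟩
      (ℤ.+ 1 ℚ./ size) ℚ.* ∑< size (value (f ⊕ g))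
        ≡⟨ cong ((ℤ.+ 1 ℚ./ size) ℚ.*_) (∑<-+ size (value f) (value g)) ⟩
      (ℤ.+ 1 ℚ./ size) ℚ.* (∑< size (value f) ℚ.+ ∑< size (value g))
        ≡⟨ ℚₚ.*-distribˡ-+ (ℤ.+ 1 ℚ./ size) _ _ ⟩
      _  ≡⟨ cong₂ ℚ._+_ (mean-∑ f) (mean-∑ g) ⟨
      mean f ℚ.+ mean g  ∎
      where open ≡-Reasoning

    mean-neg : ∀ f → mean (λ I → ℚ.- f I) ≡ ℚ.- mean f
    mean-neg f = begin
      mean (λ I → ℚ.- f I)  ≡⟨ mean-∑ (λ I → ℚ.- f I) ⟩
      (ℤ.+ 1 ℚ./ size) ℚ.* ∑< size (λ k → ℚ.- value f k)
        ≡⟨ cong ((ℤ.+ 1 ℚ./ size) ℚ.*_) (∑<-neg size (value f)) ⟩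
      (ℤ.+ 1 ℚ./ size) ℚ.* (ℚ.- ∑< size (value f))
        ≡⟨ ℚₚ.neg-distribʳ-* (ℤ.+ 1 ℚ./ size) _ ⟨
      _  ≡⟨ cong ℚ.-_ (mean-∑ f) ⟨
      ℚ.- mean f  ∎
      where open ≡-Reasoning

    mean-⊖ : ∀ f g → mean (f ⊖ g) ≡ mean f ℚ.- mean g
    mean-⊖ f g = trans (mean-⊕ f (λ I → ℚ.- g I)) (cong (mean f ℚ.+_) (mean-neg g))

    mean-1 : mean (λ _ → 1ℚ) ≡ 1ℚ
    mean-1 = trans (mean-∑ (λ _ → 1ℚ))
      (trans (cong ((ℤ.+ 1 ℚ./ size) ℚ.*_) (∑<-1 size)) (1/k*k≡1 size))

    mean-0 : mean (λ _ → 0ℚ) ≡ 0ℚ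
    mean-0 = trans (mean-⊖ (λ _ → 1ℚ) (λ _ → 1ℚ)) (ℚₚ.+-inverseʳ (mean (λ _ → 1ℚ)))

    -- On a cycle `ρ` only shifts the summation index, and the two boundary terms agree by
    -- `returns`. As `returns` compares underlying subsets, `f` must depend on the subset alone.
    mean-ρ : ∀ f → (∀ {I J} → set I ≡ set J → f I ≡ f J) → mean (f ∘ ρ) ≡ mean f
    mean-ρ f f-cong = begin
      mean (f ∘ ρ)  ≡⟨ mean-∑ (f ∘ ρ) ⟩
      (ℤ.+ 1 ℚ./ size) ℚ.* ∑< size (value f ∘ suc)
        ≡⟨ cong ((ℤ.+ 1 ℚ./ size) ℚ.*_) (+-cancelʳ (f start) _ _ cyclic) ⟩
      (ℤ.+ 1 ℚ./ size) ℚ.* ∑< size (value f)  ≡⟨ mean-∑ f ⟨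
      mean f  ∎
      where
      open ≡-Reasoning
      cyclic : ∑< size (value f ∘ suc) ℚ.+ f start ≡ ∑< size (value f) ℚ.+ f start
      cyclic = trans (∑<-shift size (value f)) (cong (∑< size (value f) ℚ.+_) (f-cong returns))

-- Partial sums of a palindromic composition.

partialSum-all : ∀ {t} (α : Vec ℕ t) → partialSum α t ≡ Vec.sum α
partialSum-all []      = refl
partialSum-all (x ∷ α) = cong (x +_) (partialSum-all α)

partialSum-suc : ∀ {t} (α : Vec ℕ t) i →
                 partialSum α (suc (toℕ i)) ≡ partialSum α (toℕ i) + lookup α i
partialSum-suc (x ∷ α) zero    = +-identityʳ x
partialSum-suc (x ∷ α) (suc i) = trans (cong (x +_) (partialSum-suc α i)) (sym (+-assoc x _ _))

partialSum-mono : ∀ {t} (α : Vec ℕ t) {i j} → i ≤ j → partialSum α i ≤ partialSum α j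
partialSum-mono []      {zero}  _         = z≤n
partialSum-mono []      {suc i} _         = z≤n
partialSum-mono (x ∷ α) z≤n       = z≤n
partialSum-mono (x ∷ α) (s≤s i≤j) = ℕₚ.+-monoʳ-≤ x (partialSum-mono α i≤j)

partialSum-segment : ∀ {t} (α : Vec ℕ t) {j} → j < Vec.sum α →
                     ∃ λ (i : Fin t) → partialSum α (toℕ i) ≤ j × j < partialSum α (suc (toℕ i))
partialSum-segment (x ∷ α) {j} j<Σ with j ℕₚ.<? x
... | yes j<x = zero , z≤n , subst (j <_) (sym (+-identityʳ x)) j<x
... | no  j≮x =
  let x+[j∸x]≡j = ℕₚ.m+[n∸m]≡n (ℕₚ.≮⇒≥ j≮x)
      (i , lower , upper) = partialSum-segment α
        (ℕₚ.+-cancelˡ-< x (j ∸ x) _ (subst (_< x + Vec.sum α) (sym x+[j∸x]≡j) j<Σ))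
  in suc i
   , subst (x + partialSum α (toℕ i) ≤_) x+[j∸x]≡j (ℕₚ.+-monoʳ-≤ x lower)
   , subst (_< x + partialSum α (suc (toℕ i))) x+[j∸x]≡j (ℕₚ.+-monoʳ-< x upper)

opposite+suc : ∀ {k} (i : Fin k) → toℕ (opposite i) + suc (toℕ i) ≡ k
opposite+suc {k} i = trans (cong (_+ suc (toℕ i)) (opposite-prop i)) (m∸n+n≡m (toℕ<n i))

-- Induction on `i`: the last part of the first prefix is traded, by the palindrome, for the part
-- that follows the second prefix.
partialSum-palindromic : ∀ {t} (α : Vec ℕ t) → (∀ i → lookup α i ≡ lookup α (opposite i)) →
                         ∀ i j → i + j ≡ t → partialSum α i + partialSum α j ≡ Vec.sum α
partialSum-palindromic α pal zero    j refl = partialSum-all α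
partialSum-palindromic {t} α pal (suc i) j i+j≡t = begin
  partialSum α (suc i) + partialSum α j
    ≡⟨ cong (λ k → partialSum α (suc k) + partialSum α j) p≡i ⟨
  partialSum α (suc (toℕ p)) + partialSum α j
    ≡⟨ cong (_+ partialSum α j) (partialSum-suc α p) ⟩
  partialSum α (toℕ p) + lookup α p + partialSum α j        ≡⟨ +-assoc (partialSum α (toℕ p)) _ _ ⟩
  partialSum α (toℕ p) + (lookup α p + partialSum α j)
    ≡⟨ cong₂ (λ k v → partialSum α k + (v + partialSum α j)) p≡i (pal p) ⟩
  partialSum α i + (lookup α (opposite p) + partialSum α j)
    ≡⟨ cong (partialSum α i +_) (+-comm (lookup α (opposite p)) _) ⟩
  partialSum α i + (partialSum α j + lookup α (opposite p))
    ≡⟨ cong (λ k → partialSum α i + (partialSum α k + lookup α (opposite p))) p̄≡j ⟨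
  partialSum α i + (partialSum α (toℕ (opposite p)) + lookup α (opposite p))
    ≡⟨ cong (partialSum α i +_) (partialSum-suc α (opposite p)) ⟨
  partialSum α i + partialSum α (suc (toℕ (opposite p)))
    ≡⟨ cong (λ k → partialSum α i + partialSum α (suc k)) p̄≡j ⟩
  partialSum α i + partialSum α (suc j)
    ≡⟨ partialSum-palindromic α pal i (suc j) (trans (+-suc i j) i+j≡t) ⟩
  Vec.sum α                                                 ∎
  where
  open ≡-Reasoning
  i<t : i < t
  i<t = subst (suc i ≤_) i+j≡t (ℕₚ.m≤m+n (suc i) j)
  p : Fin t
  p = fromℕ< i<t
  p≡i : toℕ p ≡ i
  p≡i = toℕ-fromℕ< i<t
  p̄≡j : toℕ (opposite p) ≡ j
  p̄≡j = ℕₚ.+-cancelʳ-≡ (suc i) _ _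
    (trans (cong (λ k → toℕ (opposite p) + suc k) (sym p≡i))
    (trans (opposite+suc p) (trans (sym i+j≡t) (+-comm (suc i) j))))

-- `Star` exposes the first step of a chain, while a test of minimality needs the last one, the
-- cover just below the end point.
star-last : ∀ {A : Set} {_∼_ : Rel A 0ℓ} {x y} → Star _∼_ x y →
            x ≡ y ⊎ ∃ λ z → Star _∼_ x z × z ∼ y
star-last ε = inj₁ refl
star-last (x∼ ◅ rest) with star-last rest
... | inj₁ refl            = inj₂ (_ , ε , x∼)
... | inj₂ (z , init , z∼) = inj₂ (z , x∼ ◅ init , z∼)

-- Edges of a palindromic fence and their reflection.

module PalindromicFence {m : ℕ} (P : FenceParameters m)
  (palindromic : FenceParameters.IsPalindromic P) (t-odd : parity (2 + m) ≡ 1ℙ) where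

  open FenceParameters P
  open Fence P
  open RowmotionProperties _≼?_ _◅◅_ ε

  Σα≡1+n : Vec.sum α ≡ suc n
  Σα≡1+n = sym (ℕₚ.m+[n∸m]≡n (≤-trans (α≥1 zero) (lookup≤sum α)))
    where
    lookup≤sum : ∀ {k} (β : Vec ℕ (suc k)) → lookup β zero ≤ Vec.sum β
    lookup≤sum (x ∷ β) = ℕₚ.m≤m+n x _

  a-mirror : ∀ i j → i + j ≡ 2 + m → a i + a j ≡ suc n
  a-mirror i j i+j≡t = trans (partialSum-palindromic α palindromic i j i+j≡t) Σα≡1+n

  a[t]≡1+n : a (2 + m) ≡ suc n
  a[t]≡1+n = a-mirror 0 (2 + m) refl

  -- The edge j joins x_j to x_{j+1}, with the virtual x_0 and x_{n+1} allowed.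
  Directed : Parity → ℕ → Set
  Directed d j = ∃ λ i → InSegment j i × parity (suc (toℕ i)) ≡ d

  Up Down : ℕ → Set
  Up   = Directed 1ℙ
  Down = Directed 0ℙ

  inSegment-unique : ∀ {j i i′} → InSegment j i → InSegment j i′ → i ≡ i′
  inSegment-unique {j} {i} {i′} (l , u) (l′ , u′) with ℕₚ.<-cmp (toℕ i) (toℕ i′)
  ... | tri< i<i′ _ _ = contradiction (≤-trans (≤-trans u (partialSum-mono α i<i′)) l′) (ℕₚ.<-irrefl refl)
  ... | tri≈ _ i≡i′ _ = toℕ-injective i≡i′
  ... | tri> _ _ i′<i = contradiction (≤-trans (≤-trans u′ (partialSum-mono α i′<i)) l) (ℕₚ.<-irrefl refl)

  ¬Up×Down : ∀ {j} → Up j → ¬ Down j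
  ¬Up×Down (i , i∋j , up) (i′ , i′∋j , down) with inSegment-unique i∋j i′∋j
  ... | refl with trans (sym up) down
  ...   | ()

  up⊎down : ∀ {j} → j ≤ n → Up j ⊎ Down j
  up⊎down {j} j≤n with partialSum-segment α (subst (j <_) (sym Σα≡1+n) (s≤s j≤n))
  ... | i , i∋j with parity (suc (toℕ i)) in d
  ...   | 1ℙ = inj₁ (i , i∋j , d)
  ...   | 0ℙ = inj₂ (i , i∋j , d)

  -- Reflection takes the 1-based segment i to t + 1 - i, of the same parity since t is odd, and
  -- `a-mirror` exchanges lower and upper bounds. Directions along the index are kept while the ends
  -- of an edge swap, so sending x_k to x_{n+1-k} reverses the order.
  mirror : ∀ {d j j′} → j + j′ ≡ n → Directed d j → Directed d j′
  mirror {d} {j} {j′} j+j′≡n (i , (l , u) , i-dir) =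
    opposite i , (lower , upper) , trans parity-mirror i-dir
    where
    i+ī : toℕ i + suc (toℕ (opposite i)) ≡ 2 + m
    i+ī = trans (+-suc (toℕ i) _) (trans (+-comm (suc (toℕ i)) _) (opposite+suc i))

    parity-cancel : ∀ p q → p ℙ.+ q ≡ 1ℙ → q ≡ p ℙ.⁻¹
    parity-cancel 0ℙ q eq = eq
    parity-cancel 1ℙ 0ℙ eq = refl
    parity-cancel 1ℙ 1ℙ ()

    parity-mirror : parity (suc (toℕ (opposite i))) ≡ parity (suc (toℕ i))
    parity-mirror = begin
      parity (suc (toℕ (opposite i)))   ≡⟨ parity-cancel (parity (toℕ i)) _
                                             (trans (sym (ℙₚ.+-homo-+ (toℕ i) _)) (trans (cong parity i+ī) t-odd)) ⟩
      parity (toℕ i) ℙ.⁻¹               ≡⟨ cong ℙ._⁻¹ (ℙₚ.suc-homo-⁻¹ (toℕ i)) ⟨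
      (parity (suc (toℕ i)) ℙ.⁻¹) ℙ.⁻¹  ≡⟨ ℙₚ.⁻¹-involutive _ ⟩
      parity (suc (toℕ i))              ∎
      where open ≡-Reasoning

    open ℕₚ.≤-Reasoning

    lower : a (toℕ (opposite i)) ≤ j′
    lower = ℕₚ.+-cancelʳ-≤ (a (suc (toℕ i))) _ _ (begin
      a (toℕ (opposite i)) + a (suc (toℕ i))  ≡⟨ a-mirror (toℕ (opposite i)) _ (opposite+suc i) ⟩
      suc n                                   ≡⟨ cong suc (trans (+-comm j′ j) j+j′≡n) ⟨
      suc (j′ + j)                            ≡⟨ +-suc j′ j ⟨
      j′ + suc j                              ≤⟨ ℕₚ.+-monoʳ-≤ j′ u ⟩
      j′ + a (suc (toℕ i))                    ∎)

    upper : j′ < a (suc (toℕ (opposite i)))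
    upper = ℕₚ.+-cancelˡ-≤ (a (toℕ i)) _ _ (begin
      a (toℕ i) + suc j′                        ≤⟨ ℕₚ.+-monoˡ-≤ (suc j′) l ⟩
      j + suc j′                                ≡⟨ trans (+-suc j j′) (cong suc j+j′≡n) ⟩
      suc n                                     ≡⟨ a-mirror (toℕ i) _ i+ī ⟨
      a (toℕ i) + a (suc (toℕ (opposite i)))    ∎)

  -- Both virtual edges rise, here and in `up-n`: x_0 sits below x_1 and x_{n+1} above x_n, which
  -- agrees with their constant membership.
  up-0 : Up 0
  up-0 = zero , (z≤n , first-nonempty α (α≥1 zero)) , refl
    where
    first-nonempty : ∀ {k} (β : Vec ℕ (suc k)) → 1 ≤ lookup β zero → 0 < partialSum β 1
    first-nonempty (x ∷ β) 1≤x = ≤-trans 1≤x (ℕₚ.m≤m+n x 0)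

  up-n : Up n
  up-n = mirror refl up-0

  index-s : ∀ i → index (s i) ≡ a (suc (toℕ i))
  index-s i = trans (cong suc (toℕ-fromℕ< _)) (ℕₚ.suc-pred (a (suc (toℕ i))) {{ℕ.>-nonZero a>0}})
    where
    a>0 : 0 < a (suc (toℕ i))
    a>0 = ≤-trans (proj₂ (proj₁ (proj₂ up-0))) (partialSum-mono α (s≤s z≤n))

  index-injective : ∀ {p q} → index p ≡ index q → p ≡ q
  index-injective eq = toℕ-injective (ℕₚ.suc-injective eq)

  s-opposite : ∀ i → s (opposite i) ≡ opposite (s i)
  s-opposite i = index-injective (ℕₚ.+-cancelʳ-≡ (index (s i)) _ _ (begin
    index (s (opposite i)) + index (s i)          ≡⟨ cong₂ _+_ (index-s (opposite i)) (index-s i) ⟩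
    a (suc (toℕ (opposite i))) + a (suc (toℕ i))
      ≡⟨ a-mirror (suc (toℕ (opposite i))) _ (cong suc (opposite+suc i)) ⟩
    suc n                                         ≡⟨ cong suc (opposite+suc (s i)) ⟨
    index (opposite (s i)) + index (s i)          ∎))
    where open ≡-Reasoning

  -- If the right-hand edge of `p` still lay in the segment of the left-hand one, the directions
  -- would agree; hence `p` ends that segment. It is not the last segment, which ends at `suc n`,
  -- beyond every element.
  turn⇒shared : ∀ {d d′ p} → Directed d (toℕ p) → Directed d′ (index p) → d ≢ d′ → ∃ λ i → s i ≡ p
  turn⇒shared {p = p} (i , (l , u) , dir) (i′ , i′∋ , dir′) d≢d′ =
    fromℕ< i<1+m , index-injective (trans (index-s _)
      (trans (cong (a ∘ suc) (toℕ-fromℕ< i<1+m)) (sym k≡a)))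
    where
    i∌ : ¬ (index p < a (suc (toℕ i)))
    i∌ k<a = d≢d′ (trans (sym dir)
      (trans (cong (parity ∘ suc ∘ toℕ) (inSegment-unique {i = i} (ℕₚ.m≤n⇒m≤1+n l , k<a) i′∋)) dir′))

    k≡a : index p ≡ a (suc (toℕ i))
    k≡a = ℕₚ.≤-antisym u (ℕₚ.≮⇒≥ i∌)

    i<1+m : toℕ i < suc m
    i<1+m = ℕₚ.≰⇒> λ 1+m≤i → ℕₚ.<-irrefl refl (begin-strict
      suc n               ≡⟨ a[t]≡1+n ⟨
      a (2 + m)           ≤⟨ partialSum-mono α (s≤s 1+m≤i) ⟩
      a (suc (toℕ i))     ≡⟨ k≡a ⟨
      index p             ≤⟨ toℕ<n p ⟩
      n                   <⟨ ℕₚ.n<1+n n ⟩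
      suc n               ∎)
      where open ℕₚ.≤-Reasoning

  -- Covers, membership and maximality expressed through neighbouring indices.

  up-⋖ : ∀ {p q} → Up (index p) → index q ≡ suc (index p) → p ⋖ q
  up-⋖ (i , i∋ , dir) eq = i , inj₁ (eq , i∋ , dir)

  down-⋖ : ∀ {p q} → Down (index q) → index p ≡ suc (index q) → p ⋖ q
  down-⋖ (i , i∋ , dir) eq = i , inj₂ (eq , i∋ , dir)

  ⋖-cases : ∀ {p q} → p ⋖ q →
    (index q ≡ suc (index p) × Up (index p)) ⊎ (index p ≡ suc (index q) × Down (index q))
  ⋖-cases (i , inj₁ (eq , i∋ , dir)) = inj₁ (eq , i , i∋ , dir)
  ⋖-cases (i , inj₂ (eq , i∋ , dir)) = inj₂ (eq , i , i∋ , dir)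

  ⋖⇒≢ : ∀ {p q} → p ⋖ q → p ≢ q
  ⋖⇒≢ p⋖q refl with ⋖-cases p⋖q
  ... | inj₁ (eq , _) = ℕₚ.1+n≢n (sym eq)
  ... | inj₂ (eq , _) = ℕₚ.1+n≢n (sym eq)

  -- The first alternative is the virtual x_0. No `p` has index `suc n`, so x_{n+1} lies in no ideal
  -- without a clause of its own.
  Mem : OrderIdeal → ℕ → Set
  Mem I j = j ≡ 0 ⊎ ∃ λ p → index p ≡ j × p ∈ set I

  mem? : ∀ I j → Dec (Mem I j)
  mem? I j = (j ℕₚ.≟ 0) ⊎-dec any? λ p → (index p ℕₚ.≟ j) ×-dec (p ∈? set I)

  mem-index⁺ : ∀ I {p} → p ∈ set I → Mem I (index p)
  mem-index⁺ I p∈I = inj₂ (_ , refl , p∈I)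

  mem-index⁻ : ∀ I {p} → Mem I (index p) → p ∈ set I
  mem-index⁻ I (inj₂ (q , eq , q∈I)) = subst (_∈ set I) (index-injective eq) q∈I

  ¬mem-top : ∀ I → ¬ Mem I (suc n)
  ¬mem-top I (inj₂ (p , eq , _)) = ℕₚ.<-irrefl (ℕₚ.suc-injective eq) (toℕ<n p)

  locate : ∀ {j} → j ≤ suc n → j ≡ 0 ⊎ j ≡ suc n ⊎ ∃ λ p → index p ≡ j
  locate {zero}  _ = inj₁ refl
  locate {suc j} (s≤s j≤n) with j ℕₚ.<? n
  ... | yes j<n = inj₂ (inj₂ (fromℕ< j<n , cong suc (toℕ-fromℕ< j<n)))
  ... | no  j≮n = inj₂ (inj₁ (cong suc (ℕₚ.≤-antisym j≤n (ℕₚ.≮⇒≥ j≮n))))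

  directed⇒≤n : ∀ {d j} → Directed d j → j ≤ n
  directed⇒≤n (i , (_ , u) , _) = ℕ.s≤s⁻¹ (≤-trans u
    (≤-trans (partialSum-mono α (toℕ<n i)) (≤-reflexive a[t]≡1+n)))

  up-mem : ∀ I {j} → Up j → Mem I (suc j) → Mem I j
  up-mem I {j} up (inj₂ (q , eq , q∈I)) = cases (locate (ℕₚ.m≤n⇒m≤1+n (directed⇒≤n up)))
    where
    cases : j ≡ 0 ⊎ j ≡ suc n ⊎ (∃ λ p → index p ≡ j) → Mem I j
    cases (inj₁ j≡0) = inj₁ j≡0
    cases (inj₂ (inj₁ j≡1+n)) = contradiction (directed⇒≤n up) (ℕₚ.<⇒≱ (≤-reflexive (sym j≡1+n)))
    cases (inj₂ (inj₂ (p , refl))) = mem-index⁺ I (downClosed I (up-⋖ up eq ◅ ε) q∈I)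

  down-mem : ∀ I {j} → Down j → Mem I j → Mem I (suc j)
  down-mem I down (inj₁ refl) = contradiction down (¬Up×Down up-0)
  down-mem I {j} down (inj₂ (p , refl , p∈I)) = cases (locate (s≤s (directed⇒≤n down)))
    where
    cases : suc j ≡ 0 ⊎ suc j ≡ suc n ⊎ (∃ λ q → index q ≡ suc j) → Mem I (suc j)
    -- The last edge rises, so a falling edge leads to a real element.
    cases (inj₂ (inj₁ eq)) = contradiction down (¬Up×Down (subst Up (sym (ℕₚ.suc-injective eq)) up-n))
    cases (inj₂ (inj₂ (q , eq))) = inj₂ (q , eq , downClosed I (down-⋖ down eq ◅ ε) p∈I)

  -- Down-closure reduces maximality to the upper covers: x_{k+1} if the edge on the right rises,
  -- x_{k-1} if the edge on the left falls.
  ∈max-mem : ∀ I p → p ∈ max (set I) ⇔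
    (Mem I (index p) × (Up (index p) → ¬ Mem I (suc (index p))) × (Down (toℕ p) → ¬ Mem I (toℕ p)))
  ∈max-mem I p = mk⇔ to from ⇔-∘ ∈max⇔ (set I)
    where
    to : _ → _
    to (p∈I , p-max) = mem-index⁺ I p∈I , above , below
      where
      ¬∈ : ∀ {q} → p ⋖ q → q ∉ set I
      ¬∈ p⋖q q∈I = ⋖⇒≢ p⋖q (sym (p-max _ q∈I (p⋖q ◅ ε)))
      above : Up (index p) → ¬ Mem I (suc (index p))
      above up (inj₂ (q , eq , q∈I)) = ¬∈ (up-⋖ up eq) q∈I
      below : Down (toℕ p) → ¬ Mem I (toℕ p)
      below down (inj₁ eq) = ¬Up×Down up-0 (subst Down eq down)
      below down (inj₂ (q , eq , q∈I)) = ¬∈ (down-⋖ (subst Down (sym eq) down) (cong suc (sym eq))) q∈I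

    from : _ → IsMaximalIn (set I) p
    from (M , above , below) = mem-index⁻ I M , p-max
      where
      upper-cover∉I : ∀ {z} → p ⋖ z → z ∉ set I
      upper-cover∉I {z} p⋖z z∈I = cases (⋖-cases p⋖z)
        where
        cases : _ → _
        cases (inj₁ (eq , up)) = above up (inj₂ (z , eq , z∈I))
        cases (inj₂ (eq , down)) = let z≡ = sym (ℕₚ.suc-injective eq) in
          below (subst Down z≡ down) (inj₂ (z , z≡ , z∈I))
      p-max : ∀ y → y ∈ set I → p ≼ y → y ≡ p
      p-max _ y∈I ε = refl
      p-max _ y∈I (p⋖z ◅ z≼y) = contradiction (downClosed I z≼y y∈I) (upper-cover∉I p⋖z)

  -- Dual to `∈max-mem` through `max-ρ⇔min-∁`: minimality outside `I` means that all lower covers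
  -- lie in `I`. The virtual x_0 below x_1 always does.
  ∈max-ρ-mem : ∀ I p → p ∈ max (set (ρ I)) ⇔
    (¬ Mem I (index p) × (Up (toℕ p) → Mem I (toℕ p)) × (Down (index p) → Mem I (suc (index p))))
  ∈max-ρ-mem I p = mk⇔ to from ⇔-∘ (max-ρ⇔min-∁ I ⇔-∘ ∈max⇔ (set (ρ I)))
    where
    to : _ → _
    to (p∉I , p-min) = x∈∁p⇒x∉p p∉I ∘ mem-index⁻ I , below , above
      where
      ∈I : ∀ {q} → q ⋖ p → q ∈ set I
      ∈I q⋖p = x∉∁p⇒x∈p λ q∉I → ⋖⇒≢ q⋖p (p-min _ q∉I (q⋖p ◅ ε))
      below : Up (toℕ p) → Mem I (toℕ p)
      below up with locate (ℕₚ.m≤n⇒m≤1+n (directed⇒≤n up))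
      ... | inj₁ eq = inj₁ eq
      ... | inj₂ (inj₁ eq) = contradiction (toℕ<n p)
        (ℕₚ.<⇒≱ (ℕₚ.m≤n⇒m≤1+n (≤-reflexive (sym eq))))
      ... | inj₂ (inj₂ (q , eq)) = inj₂ (q , eq , ∈I (up-⋖ (subst Up (sym eq) up) (cong suc (sym eq))))
      above : Down (index p) → Mem I (suc (index p))
      above down with locate (s≤s (directed⇒≤n down))
      ... | inj₂ (inj₁ eq) = contradiction down (¬Up×Down (subst Up (sym (ℕₚ.suc-injective eq)) up-n))
      ... | inj₂ (inj₂ (q , eq)) = inj₂ (q , eq , ∈I (down-⋖ down eq))

    from : _ → IsMinimalIn (∁ (set I)) p
    from (¬M , below , above) = x∉p⇒x∈∁p (¬M ∘ mem-index⁺ I) , p-min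
      where
      lower-cover∈I : ∀ {z} → z ⋖ p → z ∈ set I
      lower-cover∈I {z} z⋖p = cases (⋖-cases z⋖p)
        where
        cases : _ → _
        cases (inj₁ (eq , up)) = let z≡ = sym (ℕₚ.suc-injective eq) in
          mem-index⁻ I (subst (Mem I) (sym z≡) (below (subst Up z≡ up)))
        cases (inj₂ (eq , down)) = mem-index⁻ I (subst (Mem I) (sym eq) (above down))
      p-min : ∀ y → y ∈ ∁ (set I) → y ≼ p → y ≡ p
      p-min y y∉I y≼p = cases (star-last y≼p)
        where
        cases : y ≡ p ⊎ (∃ λ z → y ≼ z × z ⋖ p) → y ≡ p
        cases (inj₁ y≡p) = y≡p
        -- A nontrivial chain ends with a lower cover of `p`, which lies in `I` and pulls `y` into
        -- `I`.
        cases (inj₂ (z , y≼z , z⋖p)) =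
          contradiction (downClosed I y≼z (lower-cover∈I z⋖p)) (x∈∁p⇒x∉p y∉I)

  -- Antichain indicators as differences of ideal indicators.

  opaque
    e : ℕ → Statistic
    e j I = ⟦ mem? I j ⟧

    e-0 : ∀ I → e 0 I ≡ 1ℚ
    e-0 I = refl

    e-top : ∀ I → e (suc n) I ≡ 0ℚ
    e-top I = ⟦⟧-false (mem? I (suc n)) (¬mem-top I)

    e-index : ∀ p I → e (index p) I ≡ χ̂ p I
    e-index p I = ⟦⟧-cong (mk⇔ (mem-index⁻ I) (mem-index⁺ I)) (mem? I (index p)) (p ∈? set I)

    -- Inside a rising segment the right neighbour is the only upper cover, and `up-mem` makes the
    -- two memberships nested.
    χ-up : ∀ p → Up (toℕ p) → Up (index p) → ∀ I → χ p I ≡ (e (index p) ⊖ e (suc (index p))) I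
    χ-up p up₁ up₂ I = ⟦⟧-difference (up-mem I up₂)
      (mk⇔ (λ (M , above , _) → M , above up₂)
           (λ (M , ¬M) → M , (λ _ → ¬M) , λ down → contradiction down (¬Up×Down up₁))
        ⇔-∘ ∈max-mem I p)
      (p ∈? max (set I)) (mem? I (index p)) (mem? I (suc (index p)))

    χ-down : ∀ p → Down (toℕ p) → Down (index p) → ∀ I → χ p I ≡ (e (index p) ⊖ e (toℕ p)) I
    χ-down p down₁ down₂ I = ⟦⟧-difference (down-mem I down₁)
      (mk⇔ (λ (M , _ , below) → M , below down₁)
           (λ (M , ¬M) → M , (λ up → contradiction down₂ (¬Up×Down up)) , λ _ → ¬M)
        ⇔-∘ ∈max-mem I p)
      (p ∈? max (set I)) (mem? I (index p)) (mem? I (toℕ p))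

    -- A peak has no upper cover, so it is maximal as soon as it belongs to the ideal.
    χ-peak : ∀ p → Up (toℕ p) → Down (index p) → ∀ I → χ p I ≡ e (index p) I
    χ-peak p up down I = ⟦⟧-cong
      (mk⇔ proj₁
           (λ M → M , (λ up′ → contradiction down (¬Up×Down up′)) , λ down′ → contradiction down′ (¬Up×Down up))
        ⇔-∘ ∈max-mem I p)
      (p ∈? max (set I)) (mem? I (index p))

    χ∘ρ-up : ∀ p → Up (toℕ p) → Up (index p) → ∀ I → χ p (ρ I) ≡ (e (toℕ p) ⊖ e (index p)) I
    χ∘ρ-up p up₁ up₂ I = ⟦⟧-difference (up-mem I up₁)
      (mk⇔ (λ (¬M , below , _) → below up₁ , ¬M)
           (λ (M , ¬M) → ¬M , (λ _ → M) , λ down → contradiction down (¬Up×Down up₂))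
        ⇔-∘ ∈max-ρ-mem I p)
      (p ∈? max (set (ρ I))) (mem? I (toℕ p)) (mem? I (index p))

    χ∘ρ-down : ∀ p → Down (toℕ p) → Down (index p) → ∀ I → χ p (ρ I) ≡ (e (suc (index p)) ⊖ e (index p)) I
    χ∘ρ-down p down₁ down₂ I = ⟦⟧-difference (down-mem I down₂)
      (mk⇔ (λ (¬M , _ , above) → above down₂ , ¬M)
           (λ (M , ¬M) → ¬M , (λ up → contradiction down₁ (¬Up×Down up)) , λ _ → M)
        ⇔-∘ ∈max-ρ-mem I p)
      (p ∈? max (set (ρ I))) (mem? I (suc (index p))) (mem? I (index p))

    -- A valley has no lower cover, so it is minimal outside `I` as soon as it is missing from `I`.
    -- The constant 1 enters as the indicator of `⊤`.
    χ∘ρ-valley : ∀ p → Down (toℕ p) → Up (index p) → ∀ I → χ p (ρ I) ≡ ((λ _ → 1ℚ) ⊖ e (index p)) I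
    χ∘ρ-valley p down up I = ⟦⟧-difference {P = ⊤} _
      (mk⇔ (λ (¬M , _) → _ , ¬M)
           (λ (_ , ¬M) → ¬M , (λ up′ → contradiction down (¬Up×Down up′)) , λ down′ → contradiction down′ (¬Up×Down up))
        ⇔-∘ ∈max-ρ-mem I p)
      (p ∈? max (set (ρ I))) (yes _) (mem? I (index p))

  -- Orbit averages along the fence and their mirror sums.

  module _ (O : Orbit) where

    H : ℕ → ℚ
    H j = mean O (e j)

    H-0 : H 0 ≡ 1ℚ
    H-0 = trans (mean-cong O e-0) (mean-1 O)

    H-top : H (suc n) ≡ 0ℚ
    H-top = trans (mean-cong O e-top) (mean-0 O)

    mean-χ∘ρ : ∀ p → mean O (χ p ∘ ρ) ≡ mean O (χ p)
    mean-χ∘ρ p = mean-ρ O (χ p) (cong (λ S → indicator (max S) p))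

    mean-χ-as : ∀ p f g → (∀ I → χ p I ≡ (f ⊖ g) I) → mean O (χ p) ≡ mean O f ℚ.- mean O g
    mean-χ-as p f g eq = trans (mean-cong O eq) (mean-⊖ O f g)

    mean-χ∘ρ-as : ∀ p f g → (∀ I → χ p (ρ I) ≡ (f ⊖ g) I) → mean O (χ p) ≡ mean O f ℚ.- mean O g
    mean-χ∘ρ-as p f g eq = trans (sym (mean-χ∘ρ p)) (trans (mean-cong O eq) (mean-⊖ O f g))

    mean-χ̂ : ∀ p → mean O (χ̂ p) ≡ H (index p)
    mean-χ̂ p = sym (mean-cong O (e-index p))

    Affine : Fin n → Set
    Affine p = H (suc (index p)) ℚ.- H (index p) ≡ H (index p) ℚ.- H (toℕ p)

    -- The drops of `H` across the edges after and before `p` are both the average of `χ p`, read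
    -- from `I` as a maximal element of `I` and of `ρ I` respectively.
    affine-up : ∀ p → Up (toℕ p) → Up (index p) → Affine p
    affine-up p up₁ up₂ = begin
      H (suc (index p)) ℚ.- H (index p)        ≡⟨ swap (H (suc (index p))) (H (index p)) ⟩
      ℚ.- (H (index p) ℚ.- H (suc (index p)))
        ≡⟨ cong ℚ.-_ (trans (sym (mean-χ-as p _ _ (χ-up p up₁ up₂)))
                                                                   (mean-χ∘ρ-as p _ _ (χ∘ρ-up p up₁ up₂))) ⟩
      ℚ.- (H (toℕ p) ℚ.- H (index p))          ≡⟨ swap (H (index p)) (H (toℕ p)) ⟨
      H (index p) ℚ.- H (toℕ p)                ∎
      where
      open ≡-Reasoning
      swap : ∀ x y → x ℚ.- y ≡ ℚ.- (y ℚ.- x)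
      swap = solve 2 (λ x y → x :- y := :- (y :- x)) refl

    affine-down : ∀ p → Down (toℕ p) → Down (index p) → Affine p
    affine-down p down₁ down₂ =
      trans (sym (mean-χ∘ρ-as p _ _ (χ∘ρ-down p down₁ down₂))) (mean-χ-as p _ _ (χ-down p down₁ down₂))

    mirror-below : ∀ p → toℕ p + suc (index (opposite p)) ≡ suc n
    mirror-below p = trans (+-comm (toℕ p) _) (cong suc (trans (sym (+-suc (toℕ (opposite p)) (toℕ p))) (opposite+suc p)))

    mirror-at : ∀ p → index p + index (opposite p) ≡ suc n
    mirror-at p = trans (sym (+-suc (toℕ p) _)) (mirror-below p)

    mirror-above : ∀ p → suc (index p) + toℕ (opposite p) ≡ suc n
    mirror-above p = cong suc (trans (+-comm (index p) _) (opposite+suc p))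

    -- The defect of the mirror sum from 1. `D-mirror` trades the truncated subtraction for any
    -- partner index adding up to `suc n`.
    D : ℕ → ℚ
    D j = H j ℚ.+ H (suc n ∸ j) ℚ.- 1ℚ

    D-mirror : ∀ {i j} → i + j ≡ suc n → D i ≡ H i ℚ.+ H j ℚ.- 1ℚ
    D-mirror {i} {j} i+j≡1+n = cong (λ k → H i ℚ.+ H k ℚ.- 1ℚ)
      (trans (cong (_∸ i) (sym i+j≡1+n)) (ℕₚ.m+n∸m≡n i j))

    -- The second difference of `D` at `p` is the sum of those of `H` at `p` and at its mirror
    -- image.
    D-affine : ∀ p → Affine p → Affine (opposite p) →
               D (suc (index p)) ℚ.- D (index p) ≡ D (index p) ℚ.- D (toℕ p)
    D-affine p affine affine′ = begin
      D (suc (index p)) ℚ.- D (index p)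
        ≡⟨ cong₂ ℚ._-_ (D-mirror (mirror-above p)) (D-mirror (mirror-at p)) ⟩
      (z ℚ.+ x′ ℚ.- 1ℚ) ℚ.- (y ℚ.+ y′ ℚ.- 1ℚ)
        ≡⟨ solve 4 (λ z x′ y y′ → (z :+ x′ :- con 1ℚ) :- (y :+ y′ :- con 1ℚ) := (z :- y) :- (y′ :- x′)) refl z x′ y y′ ⟩
      (z ℚ.- y) ℚ.- (y′ ℚ.- x′)
        ≡⟨ cong₂ ℚ._-_ affine (sym affine′) ⟩
      (y ℚ.- x) ℚ.- (z′ ℚ.- y′)
        ≡⟨ solve 4 (λ y x z′ y′ → (y :- x) :- (z′ :- y′) := (y :+ y′ :- con 1ℚ) :- (x :+ z′ :- con 1ℚ)) refl y x z′ y′ ⟩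
      (y ℚ.+ y′ ℚ.- 1ℚ) ℚ.- (x ℚ.+ z′ ℚ.- 1ℚ)
        ≡⟨ cong₂ ℚ._-_ (D-mirror (mirror-at p)) (D-mirror (mirror-below p)) ⟨
      D (index p) ℚ.- D (toℕ p) ∎
      where
      open ≡-Reasoning
      p̄ = opposite p
      x = H (toℕ p)
      y = H (index p)
      z = H (suc (index p))
      x′ = H (toℕ p̄)
      y′ = H (index p̄)
      z′ = H (suc (index p̄))

    mirror-lower : ∀ {d} p → Directed d (index p) → Directed d (toℕ (opposite p))
    mirror-lower p = mirror (trans (+-comm (index p) _) (opposite+suc p))

    mirror-upper : ∀ {d} p → Directed d (toℕ p) → Directed d (index (opposite p))
    mirror-upper p = mirror (trans (+-comm (toℕ p) _)
      (trans (sym (+-suc (toℕ (opposite p)) (toℕ p))) (opposite+suc p)))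

    module _ (shared-mesic : ∀ i → mean O (χ̂ (s i) ⊕ χ̂ (s (opposite i))) ≡ 1ℚ) where

      D-shared : ∀ i → D (index (s i)) ≡ 0ℚ
      D-shared i = begin
        D (index (s i))
          ≡⟨ D-mirror (mirror-at (s i)) ⟩
        H (index (s i)) ℚ.+ H (index (opposite (s i))) ℚ.- 1ℚ
          ≡⟨ cong (λ q → H (index (s i)) ℚ.+ H (index q) ℚ.- 1ℚ) (s-opposite i) ⟨
        H (index (s i)) ℚ.+ H (index (s (opposite i))) ℚ.- 1ℚ
          ≡⟨ cong₂ (λ u v → u ℚ.+ v ℚ.- 1ℚ) (mean-χ̂ (s i)) (mean-χ̂ (s (opposite i))) ⟨
        mean O (χ̂ (s i)) ℚ.+ mean O (χ̂ (s (opposite i))) ℚ.- 1ℚ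
          ≡⟨ cong (ℚ._- 1ℚ) (trans (sym (mean-⊕ O (χ̂ (s i)) (χ̂ (s (opposite i))))) (shared-mesic i)) ⟩
        0ℚ ∎
        where open ≡-Reasoning

      Node : Fin n → Set
      Node p = D (index p) ≡ 0ℚ ⊎ D (suc (index p)) ℚ.- D (index p) ≡ D (index p) ℚ.- D (toℕ p)

      -- Two edges of equal direction at `p` are mirrored by two of that direction at `opposite p`,
      -- so `H` is affine at both. Otherwise `p` is shared, and the hypothesis gives a zero of `D`.
      node : ∀ p → Node p
      node p = cases (up⊎down (ℕₚ.<⇒≤ (toℕ<n p))) (up⊎down (toℕ<n p))
        where
        turn : (∃ λ i → s i ≡ p) → Node p
        turn (i , sᵢ≡p) = inj₁ (subst (λ q → D (index q) ≡ 0ℚ) sᵢ≡p (D-shared i))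
        cases : Up (toℕ p) ⊎ Down (toℕ p) → Up (index p) ⊎ Down (index p) → Node p
        cases (inj₁ up₁) (inj₁ up₂) = inj₂
          (D-affine p (affine-up p up₁ up₂) (affine-up (opposite p) (mirror-lower p up₂) (mirror-upper p up₁)))
        cases (inj₂ down₁) (inj₂ down₂) = inj₂
          (D-affine p (affine-down p down₁ down₂) (affine-down (opposite p) (mirror-lower p down₂) (mirror-upper p down₁)))
        cases (inj₁ up) (inj₂ down) = turn (turn⇒shared up down λ ())
        cases (inj₂ down) (inj₁ up) = turn (turn⇒shared down up λ ())

      D-zero : ∀ j → j ≤ suc n → D j ≡ 0ℚ
      D-zero = PiecewiseAffine.zero-everywhere (suc n) D
        -- At the virtual ends the defect is 1 + 0 - 1 and 0 + 1 - 1.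
        (trans (D-mirror {0} refl) (cong₂ (λ u v → u ℚ.+ v ℚ.- 1ℚ) H-0 H-top))
        (trans (D-mirror (+-identityʳ (suc n))) (cong₂ (λ u v → u ℚ.+ v ℚ.- 1ℚ) H-top H-0))
        λ k k<n → subst (λ k → D (suc k) ≡ 0ℚ ⊎ D (2 + k) ℚ.- D (suc k) ≡ D (suc k) ℚ.- D k)
          (toℕ-fromℕ< (ℕ.s≤s⁻¹ k<n)) (node (fromℕ< (ℕ.s≤s⁻¹ k<n)))

      -- The two mesic statements on a fixed orbit.

      H-mirror : ∀ {i j} → i + j ≡ suc n → H i ℚ.+ H j ≡ 1ℚ
      H-mirror {i} {j} eq = begin
        H i ℚ.+ H j
          ≡⟨ solve 2 (λ x y → x :+ y := (x :+ y :- con 1ℚ) :+ con 1ℚ) refl (H i) (H j) ⟩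
        H i ℚ.+ H j ℚ.- 1ℚ ℚ.+ 1ℚ
          ≡⟨ cong (ℚ._+ 1ℚ) (trans (sym (D-mirror eq)) (D-zero i (subst (i ≤_) eq (ℕₚ.m≤m+n i j)))) ⟩
        1ℚ                         ∎
        where open ≡-Reasoning

      mean-χ̂⊕χ̂-opposite : ∀ p → mean O (χ̂ p ⊕ χ̂ (opposite p)) ≡ 1ℚ
      mean-χ̂⊕χ̂-opposite p = trans (mean-⊕ O (χ̂ p) (χ̂ (opposite p)))
        (trans (cong₂ ℚ._+_ (mean-χ̂ p) (mean-χ̂ (opposite p))) (H-mirror (mirror-at p)))

      -- Reflection replaces `H` by 1 - `H`, which swaps the terms of a difference.
      H-difference-mirror : ∀ {i j i′ j′} → i + i′ ≡ suc n → j + j′ ≡ suc n → H i ℚ.- H j ≡ H j′ ℚ.- H i′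
      H-difference-mirror {i} {j} {i′} {j′} eqᵢ eqⱼ = begin
        H i ℚ.- H j
          ≡⟨ solve 3 (λ x y x′ → x :- y := (x :+ x′) :- (y :+ x′)) refl (H i) (H j) (H i′) ⟩
        (H i ℚ.+ H i′) ℚ.- (H j ℚ.+ H i′)
          ≡⟨ cong (ℚ._- (H j ℚ.+ H i′)) (trans (H-mirror eqᵢ) (sym (H-mirror eqⱼ))) ⟩
        (H j ℚ.+ H j′) ℚ.- (H j ℚ.+ H i′)
          ≡⟨ solve 3 (λ y y′ x′ → (y :+ y′) :- (y :+ x′) := y′ :- x′) refl (H j) (H j′) (H i′) ⟩
        H j′ ℚ.- H i′                          ∎
        where open ≡-Reasoning

      -- The reflection reverses the order, so a peak is mirrored by a valley. The averages are `y`
      -- at the peak and 1 - `y′` at the valley, and `y` and `y′` add up to 1.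
      mean-χ-peak : ∀ p → Up (toℕ p) → Down (index p) → mean O (χ p) ≡ mean O (χ (opposite p))
      mean-χ-peak p up down = begin
        mean O (χ p)                       ≡⟨ mean-cong O (χ-peak p up down) ⟩
        y                                     ≡⟨ solve 2 (λ y y′ → y := (y :+ y′) :- y′) refl y y′ ⟩
        (y ℚ.+ y′) ℚ.- y′
          ≡⟨ cong (ℚ._- y′) (trans (H-mirror (mirror-at p)) (sym (mean-1 O))) ⟩
        mean O (λ _ → 1ℚ) ℚ.- y′
          ≡⟨ mean-χ∘ρ-as (opposite p) (λ _ → 1ℚ) _ (χ∘ρ-valley (opposite p) (mirror-lower p down) (mirror-upper p up)) ⟨
        mean O (χ (opposite p))            ∎
        where
        open ≡-Reasoning
        y = H (index p)
        y′ = H (index (opposite p))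

      -- Upper covers of `p` are mirrored by lower covers of `opposite p`, so `χ p` is read from `I`
      -- and `χ (opposite p)` from `ρ I`.
      mean-χ-opposite : ∀ p → mean O (χ p) ≡ mean O (χ (opposite p))
      mean-χ-opposite p = cases (up⊎down (ℕₚ.<⇒≤ (toℕ<n p))) (up⊎down (toℕ<n p))
        where
        cases : Up (toℕ p) ⊎ Down (toℕ p) → Up (index p) ⊎ Down (index p) →
                mean O (χ p) ≡ mean O (χ (opposite p))
        cases (inj₁ up₁) (inj₁ up₂) =
          trans (mean-χ-as p _ _ (χ-up p up₁ up₂))
          (trans (H-difference-mirror (mirror-at p) (mirror-above p))
          (sym (mean-χ∘ρ-as (opposite p) _ _ (χ∘ρ-up (opposite p) (mirror-lower p up₂) (mirror-upper p up₁)))))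
        cases (inj₂ down₁) (inj₂ down₂) =
          trans (mean-χ-as p _ _ (χ-down p down₁ down₂))
          (trans (H-difference-mirror (mirror-at p) (mirror-below p))
          (sym (mean-χ∘ρ-as (opposite p) _ _ (χ∘ρ-down (opposite p) (mirror-lower p down₂) (mirror-upper p down₁)))))
        cases (inj₁ up) (inj₂ down) = mean-χ-peak p up down
        -- A valley is handled from its mirror image, which is a peak.
        cases (inj₂ down) (inj₁ up) = sym (trans
          (mean-χ-peak (opposite p) (mirror-lower p up) (mirror-upper p down))
          (cong (λ q → mean O (χ q)) (opposite-involutive p)))

      mean-χ⊖χ-opposite : ∀ p → mean O (χ p ⊖ χ (opposite p)) ≡ 0ℚ
      mean-χ⊖χ-opposite p = trans (mean-⊖ O (χ p) (χ (opposite p)))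
        (trans (cong (ℚ._- mean O (χ (opposite p))) (mean-χ-opposite p))
               (ℚₚ.+-inverseʳ (mean O (χ (opposite p)))))

theorem5p10 : (m : ℕ) (P : FenceParameters m) → FenceParameters.IsPalindromic P → parity (2 + m) ≡ 1ℙ →
    let open Fence P in
    (∀ i → (χ̂ (s i) ⊕ χ̂ (s (opposite i))) IsMesic 1ℚ) →
    (∀ k → (χ̂ k ⊕ χ̂ (opposite k)) IsMesic 1ℚ) × (∀ k → (χ k ⊖ χ (opposite k)) IsMesic 0ℚ)
theorem5p10 m P palindromic t-odd shared-mesic =
    (λ k O → trans (sym (mean≡average O _)) (mean-χ̂⊕χ̂-opposite O (shared-mean O) k))
  , (λ k O → trans (sym (mean≡average O _)) (mean-χ⊖χ-opposite O (shared-mean O) k))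
  where
  open Fence P
  open RowmotionProperties _≼?_ _◅◅_ ε
  open PalindromicFence P palindromic t-odd
  shared-mean : ∀ O i → mean O (χ̂ (s i) ⊕ χ̂ (s (opposite i))) ≡ 1ℚ
  shared-mean O i = trans (mean≡average O _) (shared-mesic i O)
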